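{- Reduction in the calculus $\lambda Q$ is confluent.
   Context: Terms up to $\alpha$-equivalence; one-step reduction is the closure of the rules under all constructors. $\lambda Q$: terms $M,N::=\uparrow V\mid x(V,y.N)\mid\mathsf{C}(M,x.N)$; values $V,W::=x\mid\lambda x.M$ (in $y(V,z.N)$ and $x.N$ the variable before the dot is bound in the following term). Value substitution $[V/y]$: homomorphic and capture-avoiding ($[V/y]y=V$, $[V/y]z=z$ for $z\neq y$), except: $[V/y](y(W,x.P))=\mathsf{C}(\uparrow V,y'.y'([V/y]W,x.[V/y]P))$ with $y'$ fresh if $V$ is an abstraction, and $[x'/y](y(W,x.P))=x'([x'/y]W,x.[x'/y]P)$. Rules: $(B_v)$ $\mathsf{C}(\uparrow(\lambda x.M),y.y(V,z.N))\to\mathsf{C}(\mathsf{C}(\uparrow V,x.M),z.N)$ if $y\notin FV(V)\cup FV(N)$; $(\sigma_v)$ $\mathsf{C}(\uparrow V,y.N)\to[V/y]N$ if the redex is not a $B_v$-redex; $(\eta_{cut})$ $\mathsf{C}(M,x.\uparrow x)\to M$; $(\pi_1)$ $\mathsf{C}(z(V,y.P),x.N)\to z(V,y.\mathsf{C}(P,x.N))$; $(\pi_2)$ $\mathsf{C}(\mathsf{C}(M,y.P),x.N)\to\mathsf{C}(M,y.\mathsf{C}(P,x.N))$. -}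

module Defs where

open import Data.Nat using (ℕ; zero; suc)
open import Data.Fin using (Fin; zero; suc)
open import Data.Product using (Σ; ∃; _×_; _,_)
open import Relation.Nullary using (¬_)
open import Relation.Binary.PropositionalEquality using (_≡_)
open import Relation.Binary.Construct.Closure.ReflexiveTransitive using (Star)

-- λQ syntax, well-scoped de Bruijn representation (terms up to α-equivalence).
-- Val n / Tm n : values / terms with at most n free variables (Fin n).
mutual
  data Val (n : ℕ) : Set where
    var : Fin n → Val n
    lam : Tm (suc n) → Val n            -- λx.M   (x = index 0 in M)

  data Tm (n : ℕ) : Set where
    up  : Val n → Tm n
    app : Fin n → Val n → Tm (suc n) → Tm n
                                        -- x(V, y.N)   (y = index 0 in N)
    cut : Tm n → Tm (suc n) → Tm n      -- C(M, x.N)   (x = index 0 in N)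

Ren : ℕ → ℕ → Set
Ren n m = Fin n → Fin m

liftR : ∀ {n m} → Ren n m → Ren (suc n) (suc m)
liftR ρ zero    = zero
liftR ρ (suc i) = suc (ρ i)

mutual
  renV : ∀ {n m} → Ren n m → Val n → Val m
  renV ρ (var x) = var (ρ x)
  renV ρ (lam M) = lam (renT (liftR ρ) M)

  renT : ∀ {n m} → Ren n m → Tm n → Tm m
  renT ρ (up V)      = up (renV ρ V)
  renT ρ (app x V N) = app (ρ x) (renV ρ V) (renT (liftR ρ) N)
  renT ρ (cut M N)   = cut (renT ρ M) (renT (liftR ρ) N)

wkV : ∀ {n} → Val n → Val (suc n)
wkV = renV suc

-- Value substitutions (parallel; the paper's [V/y] is the instance `single V`)
Sub : ℕ → ℕ → Set
Sub n m = Fin n → Val m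

liftS : ∀ {n m} → Sub n m → Sub (suc n) (suc m)
liftS σ zero    = var zero
liftS σ (suc i) = wkV (σ i)

-- substitution under the two binders y', x of  C(↑V, y'. y'(W, x.P)):
-- index 0 = x, index 1 = the fresh y'.
liftS₂ : ∀ {n m} → Sub n m → Sub (suc n) (suc (suc m))
liftS₂ σ zero    = var zero
liftS₂ σ (suc i) = renV (λ j → suc (suc j)) (σ i)

mutual
  subV : ∀ {n m} → Sub n m → Val n → Val m
  subV σ (var x) = σ x
  subV σ (lam M) = lam (subT (liftS σ) M)

  subT : ∀ {n m} → Sub n m → Tm n → Tm m
  subT σ (up V)      = up (subV σ V)
  subT σ (app y W P) = subApp σ (σ y) W P
  subT σ (cut M N)   = cut (subT σ M) (subT (liftS σ) N)

  -- the non-homomorphic clauses for y(W, x.P):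
  --   [x'/y] (y(W,x.P)) = x'([x'/y]W, x.[x'/y]P)
  --   [λz.M/y](y(W,x.P)) = C(↑(λz.M), y'. y'([V/y]W, x.[V/y]P)),  y' fresh
  subApp : ∀ {n m} → Sub n m → Val m → Val n → Tm (suc n) → Tm m
  subApp σ (var x') W P = app x' (subV σ W) (subT (liftS σ) P)
  subApp σ (lam M)  W P =
    cut (up (lam M)) (app zero (wkV (subV σ W)) (subT (liftS₂ σ) P))

single : ∀ {n} → Val n → Sub (suc n) n
single V zero    = V
single V (suc i) = var i

-- B_v-redexes: C(↑(λx.M), y. y(V, z.N)) with y ∉ FV(V) ∪ FV(N).
-- In de Bruijn form, y ∉ FV(V) means V is a weakening, and y ∉ FV(N)
-- (N under y and z; z = index 0, y = index 1) means N = renT (liftR suc) N'.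
IsBv : ∀ {n} → Val n → Tm (suc n) → Set
IsBv {n} V N =
  Σ (Tm (suc n)) λ M → Σ (Val n) λ W → Σ (Tm (suc n)) λ N' →
    (V ≡ lam M) × (N ≡ app zero (wkV W) (renT (liftR suc) N'))

infix 4 _⟶_ _⟶V_
mutual
  data _⟶_ {n : ℕ} : Tm n → Tm n → Set where
    Bv   : ∀ {M : Tm (suc n)} {V : Val n} {N : Tm (suc n)} →
           cut (up (lam M)) (app zero (wkV V) (renT (liftR suc) N))
             ⟶ cut (cut (up V) M) N
    σv   : ∀ {V : Val n} {N : Tm (suc n)} → ¬ IsBv V N →
           cut (up V) N ⟶ subT (single V) N
    ηcut : ∀ {M : Tm n} → cut M (up (var zero)) ⟶ M
    π₁   : ∀ {z : Fin n} {V : Val n} {P : Tm (suc n)} {N : Tm (suc n)} →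
           cut (app z V P) N ⟶ app z V (cut P (renT (liftR suc) N))
    π₂   : ∀ {M : Tm n} {P : Tm (suc n)} {N : Tm (suc n)} →
           cut (cut M P) N ⟶ cut M (cut P (renT (liftR suc) N))
    ξ-up   : ∀ {V V'} → V ⟶V V' → up V ⟶ up V'
    ξ-appV : ∀ {x V V' N} → V ⟶V V' → app x V N ⟶ app x V' N
    ξ-appN : ∀ {x V N N'} → N ⟶ N' → app x V N ⟶ app x V N'
    ξ-cutL : ∀ {M M' N} → M ⟶ M' → cut M N ⟶ cut M' N
    ξ-cutR : ∀ {M N N'} → N ⟶ N' → cut M N ⟶ cut M N'

  data _⟶V_ {n : ℕ} : Val n → Val n → Set where
    ξ-lam : ∀ {M M'} → M ⟶ M' → lam M ⟶V lam M'

infix 4 _⟶*_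
_⟶*_ : ∀ {n} → Tm n → Tm n → Set
_⟶*_ = Star _⟶_

Confluent : Set
Confluent = ∀ {n} {M N₁ N₂ : Tm n} → M ⟶* N₁ → M ⟶* N₂ →
            ∃ λ P → (N₁ ⟶* P) × (N₂ ⟶* P)

-- Hardin's interpretation method. Every term reduces to its π-normal form πnfT M, and a step
-- M ⟶ N is mirrored by one parallel step πnfT M ⇛ πnfT N, where ⇛ contracts σ-redexes and, in
-- one go, the B_v-redex that σ creates when it substitutes an abstraction for a head variable
-- (followed by the π-steps that restore π-normality). Parallel reduction is contained in ⟶*
-- and has the triangle property with respect to its complete development devT (Takahashi), so
-- it is confluent, and confluence transfers back to ⟶ along πnfT.
module Submission where

open import Defs
open import Data.Product using (∃; _×_; _,_)
open import Data.Nat using (ℕ; zero; suc)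
open import Data.Fin using (Fin; zero; suc)
import Data.Fin as Fin
open import Function.Base using (_∘_)
open import Relation.Binary.Core using (Rel)
import Relation.Binary.Rewriting as Rewriting
open import Relation.Binary.PropositionalEquality
  using (_≡_; _≗_; refl; sym; trans; cong; cong₂; subst; module ≡-Reasoning)
open import Relation.Nullary using (Dec; yes; no)
open import Relation.Nullary.Decidable using (map′; _×-dec_)
open import Relation.Binary.Construct.Closure.ReflexiveTransitive
  using (Star; ε; _◅_; _◅◅_; gmap; fold)
open import Relation.Binary.Construct.Closure.ReflexiveTransitive.Properties using (module StarReasoning)

module _ {a ℓ} {A : Set a} {_⇒_ : Rel A ℓ}
         (dev : A → A) (triangle : ∀ {x y} → x ⇒ y → y ⇒ dev x) where

  private
    strip : ∀ {x y z} → x ⇒ y → Star _⇒_ x z → ∃ λ w → Star _⇒_ y w × z ⇒ w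
    strip {y = y} r ε = y , ε , r
    strip r (s ◅ ss) with strip (triangle s) ss
    ... | w , rs , s′ = w , triangle r ◅ rs , s′

  triangle⇒confluent : Rewriting.Confluent _⇒_
  triangle⇒confluent {C = z} ε ss = z , ss , ε
  triangle⇒confluent (r ◅ rs) ss with strip r ss
  ... | w , ss′ , r′ with triangle⇒confluent rs ss′
  ... | v , rs′ , ss″ = v , rs′ , r′ ◅ ss″

module _ {a ℓ₁ ℓ₂} {A : Set a} {_⟶ᴬ_ : Rel A ℓ₁} {_⇒_ : Rel A ℓ₂} where

  confluent-by-interpretation :
    (t : A → A) →
    (∀ x → Star _⟶ᴬ_ x (t x)) →
    (∀ {x y} → x ⟶ᴬ y → t x ⇒ t y) →
    (∀ {x y} → x ⇒ y → Star _⟶ᴬ_ x y) →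
    Rewriting.Confluent _⇒_ → Rewriting.Confluent _⟶ᴬ_
  confluent-by-interpretation t reduces-to-t simulate sound confluent {B = y} {C = z} rs ss
    with confluent (gmap t simulate rs) (gmap t simulate ss)
  ... | w , rs′ , ss′ = w , reduces-to-t y ◅◅ sound* rs′ , reduces-to-t z ◅◅ sound* ss′
    where
    sound* : ∀ {x y} → Star _⇒_ x y → Star _⟶ᴬ_ x y
    sound* = fold (Star _⟶ᴬ_) (λ r rs → sound r ◅◅ rs) ε

cong₃ : ∀ {A B C D : Set} (f : A → B → C → D) {a a′ b b′ c c′} →
        a ≡ a′ → b ≡ b′ → c ≡ c′ → f a b c ≡ f a′ b′ c′
cong₃ f refl refl refl = refl

liftR-cong : ∀ {n m} {ρ ρ′ : Ren n m} → ρ ≗ ρ′ → liftR ρ ≗ liftR ρ′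
liftR-cong e zero    = refl
liftR-cong e (suc i) = cong suc (e i)

mutual
  renV-cong : ∀ {n m} {ρ ρ′ : Ren n m} → ρ ≗ ρ′ → renV ρ ≗ renV ρ′
  renV-cong e (var x) = cong var (e x)
  renV-cong e (lam M) = cong lam (renT-cong (liftR-cong e) M)

  renT-cong : ∀ {n m} {ρ ρ′ : Ren n m} → ρ ≗ ρ′ → renT ρ ≗ renT ρ′
  renT-cong e (up V)      = cong up (renV-cong e V)
  renT-cong e (app x V N) = cong₃ app (e x) (renV-cong e V) (renT-cong (liftR-cong e) N)
  renT-cong e (cut M N)   = cong₂ cut (renT-cong e M) (renT-cong (liftR-cong e) N)

liftR-∘ : ∀ {n m k} (ρ′ : Ren m k) (ρ : Ren n m) → liftR ρ′ ∘ liftR ρ ≗ liftR (ρ′ ∘ ρ)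
liftR-∘ ρ′ ρ zero    = refl
liftR-∘ ρ′ ρ (suc i) = refl

mutual
  renV-∘ : ∀ {n m k} (ρ′ : Ren m k) (ρ : Ren n m) → renV ρ′ ∘ renV ρ ≗ renV (ρ′ ∘ ρ)
  renV-∘ ρ′ ρ (var x) = refl
  renV-∘ ρ′ ρ (lam M) = cong lam (renT-under-∘ ρ′ ρ M)

  renT-∘ : ∀ {n m k} (ρ′ : Ren m k) (ρ : Ren n m) → renT ρ′ ∘ renT ρ ≗ renT (ρ′ ∘ ρ)
  renT-∘ ρ′ ρ (up V)      = cong up (renV-∘ ρ′ ρ V)
  renT-∘ ρ′ ρ (app x V N) = cong₂ (app (ρ′ (ρ x))) (renV-∘ ρ′ ρ V) (renT-under-∘ ρ′ ρ N)
  renT-∘ ρ′ ρ (cut M N)   = cong₂ cut (renT-∘ ρ′ ρ M) (renT-under-∘ ρ′ ρ N)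

  renT-under-∘ : ∀ {n m k} (ρ′ : Ren m k) (ρ : Ren n m) →
                 renT (liftR ρ′) ∘ renT (liftR ρ) ≗ renT (liftR (ρ′ ∘ ρ))
  renT-under-∘ ρ′ ρ M = trans (renT-∘ _ _ M) (renT-cong (liftR-∘ ρ′ ρ) M)

renV-wkV : ∀ {n m} (ρ : Ren n m) V → renV (liftR ρ) (wkV V) ≡ wkV (renV ρ V)
renV-wkV ρ V = trans (renV-∘ (liftR ρ) suc V) (sym (renV-∘ suc ρ V))

wk₁ : ∀ {n} → Tm (suc n) → Tm (suc (suc n))
wk₁ = renT (liftR suc)

renT-wk₁ : ∀ {n m} (ρ : Ren n m) N → renT (liftR (liftR ρ)) (wk₁ N) ≡ wk₁ (renT (liftR ρ) N)
renT-wk₁ ρ N = trans (renT-∘ _ _ N) (trans (renT-cong swap N) (sym (renT-∘ _ _ N)))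
  where
  swap : liftR (liftR ρ) ∘ liftR suc ≗ liftR suc ∘ liftR ρ
  swap zero    = refl
  swap (suc i) = refl

liftS-cong : ∀ {n m} {σ σ′ : Sub n m} → σ ≗ σ′ → liftS σ ≗ liftS σ′
liftS-cong e zero    = refl
liftS-cong e (suc i) = cong wkV (e i)

liftS₂-cong : ∀ {n m} {σ σ′ : Sub n m} → σ ≗ σ′ → liftS₂ σ ≗ liftS₂ σ′
liftS₂-cong e zero    = refl
liftS₂-cong e (suc i) = cong (renV (λ j → suc (suc j))) (e i)

mutual
  subV-cong : ∀ {n m} {σ σ′ : Sub n m} → σ ≗ σ′ → subV σ ≗ subV σ′
  subV-cong e (var x) = e x
  subV-cong e (lam M) = cong lam (subT-cong (liftS-cong e) M)

  subT-cong : ∀ {n m} {σ σ′ : Sub n m} → σ ≗ σ′ → subT σ ≗ subT σ′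
  subT-cong e (up V)                = cong up (subV-cong e V)
  subT-cong {σ = σ} e (app y W P) = trans (cong (λ X → subApp σ X W P) (e y)) (subApp-cong e _ W P)
  subT-cong e (cut M N)             = cong₂ cut (subT-cong e M) (subT-cong (liftS-cong e) N)

  subApp-cong : ∀ {n m} {σ σ′ : Sub n m} → σ ≗ σ′ →
                ∀ X W P → subApp σ X W P ≡ subApp σ′ X W P
  subApp-cong e (var x) W P = cong₂ (app x) (subV-cong e W) (subT-cong (liftS-cong e) P)
  subApp-cong e (lam M) W P =
    cong (cut (up (lam M))) (cong₂ (app zero) (cong wkV (subV-cong e W)) (subT-cong (liftS₂-cong e) P))

liftS-liftR : ∀ {n m k} (σ : Sub m k) (ρ : Ren n m) → liftS σ ∘ liftR ρ ≗ liftS (σ ∘ ρ)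
liftS-liftR σ ρ zero    = refl
liftS-liftR σ ρ (suc i) = refl

liftS₂-liftR : ∀ {n m k} (σ : Sub m k) (ρ : Ren n m) → liftS₂ σ ∘ liftR ρ ≗ liftS₂ (σ ∘ ρ)
liftS₂-liftR σ ρ zero    = refl
liftS₂-liftR σ ρ (suc i) = refl

mutual
  subV-renV : ∀ {n m k} (σ : Sub m k) (ρ : Ren n m) V → subV σ (renV ρ V) ≡ subV (σ ∘ ρ) V
  subV-renV σ ρ (var x) = refl
  subV-renV σ ρ (lam M) = cong lam (trans (subT-renT _ _ M) (subT-cong (liftS-liftR σ ρ) M))

  subT-renT : ∀ {n m k} (σ : Sub m k) (ρ : Ren n m) M → subT σ (renT ρ M) ≡ subT (σ ∘ ρ) M
  subT-renT σ ρ (up V)      = cong up (subV-renV σ ρ V)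
  subT-renT σ ρ (app y W P) = subApp-renT σ ρ (σ (ρ y)) W P
  subT-renT σ ρ (cut M N)   =
    cong₂ cut (subT-renT σ ρ M) (trans (subT-renT _ _ N) (subT-cong (liftS-liftR σ ρ) N))

  subApp-renT : ∀ {n m k} (σ : Sub m k) (ρ : Ren n m) X W P →
                subApp σ X (renV ρ W) (renT (liftR ρ) P) ≡ subApp (σ ∘ ρ) X W P
  subApp-renT σ ρ (var x) W P =
    cong₂ (app x) (subV-renV σ ρ W) (trans (subT-renT _ _ P) (subT-cong (liftS-liftR σ ρ) P))
  subApp-renT σ ρ (lam M) W P = cong (cut (up (lam M))) (cong₂ (app zero)
    (cong wkV (subV-renV σ ρ W)) (trans (subT-renT _ _ P) (subT-cong (liftS₂-liftR σ ρ) P)))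

liftR-liftS : ∀ {n m k} (ρ : Ren m k) (σ : Sub n m) →
              renV (liftR ρ) ∘ liftS σ ≗ liftS (renV ρ ∘ σ)
liftR-liftS ρ σ zero    = refl
liftR-liftS ρ σ (suc i) = renV-wkV ρ (σ i)

liftR-liftS₂ : ∀ {n m k} (ρ : Ren m k) (σ : Sub n m) →
               renV (liftR (liftR ρ)) ∘ liftS₂ σ ≗ liftS₂ (renV ρ ∘ σ)
liftR-liftS₂ ρ σ zero    = refl
liftR-liftS₂ ρ σ (suc i) = trans (renV-∘ _ _ (σ i)) (sym (renV-∘ _ ρ (σ i)))

mutual
  renV-subV : ∀ {n m k} (ρ : Ren m k) (σ : Sub n m) V → renV ρ (subV σ V) ≡ subV (renV ρ ∘ σ) V
  renV-subV ρ σ (var x) = refl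
  renV-subV ρ σ (lam M) = cong lam (trans (renT-subT _ _ M) (subT-cong (liftR-liftS ρ σ) M))

  renT-subT : ∀ {n m k} (ρ : Ren m k) (σ : Sub n m) M → renT ρ (subT σ M) ≡ subT (renV ρ ∘ σ) M
  renT-subT ρ σ (up V)      = cong up (renV-subV ρ σ V)
  renT-subT ρ σ (app y W P) = renT-subApp ρ σ (σ y) W P
  renT-subT ρ σ (cut M N)   =
    cong₂ cut (renT-subT ρ σ M) (trans (renT-subT _ _ N) (subT-cong (liftR-liftS ρ σ) N))

  renT-subApp : ∀ {n m k} (ρ : Ren m k) (σ : Sub n m) X W P →
                renT ρ (subApp σ X W P) ≡ subApp (renV ρ ∘ σ) (renV ρ X) W P
  renT-subApp ρ σ (var x) W P =
    cong₂ (app (ρ x)) (renV-subV ρ σ W) (trans (renT-subT _ _ P) (subT-cong (liftR-liftS ρ σ) P))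
  renT-subApp ρ σ (lam M) W P = cong (cut (up (lam (renT (liftR ρ) M)))) (cong₂ (app zero)
    (trans (renV-wkV ρ (subV σ W)) (cong wkV (renV-subV ρ σ W)))
    (trans (renT-subT _ _ P) (subT-cong (liftR-liftS₂ ρ σ) P)))

subV-liftS-wkV : ∀ {n m} (τ : Sub n m) V → subV (liftS τ) (wkV V) ≡ wkV (subV τ V)
subV-liftS-wkV τ V = trans (subV-renV (liftS τ) suc V) (sym (renV-subV suc τ V))

liftS-subV : ∀ {n m k} (τ : Sub m k) (σ : Sub n m) →
             subV (liftS τ) ∘ liftS σ ≗ liftS (subV τ ∘ σ)
liftS-subV τ σ zero    = refl
liftS-subV τ σ (suc i) = subV-liftS-wkV τ (σ i)

liftS₂-subV : ∀ {n m k} (τ : Sub m k) (σ : Sub n m) →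
              subV (liftS₂ τ) ∘ liftS σ ≗ liftS₂ (subV τ ∘ σ)
liftS₂-subV τ σ zero    = refl
liftS₂-subV τ σ (suc i) = trans (subV-renV (liftS₂ τ) suc (σ i)) (sym (renV-subV _ τ (σ i)))

liftS-liftS₂-subV : ∀ {n m k} (τ : Sub m k) (σ : Sub n m) →
                    subV (liftS (liftS τ)) ∘ liftS₂ σ ≗ liftS₂ (subV τ ∘ σ)
liftS-liftS₂-subV τ σ zero    = refl
liftS-liftS₂-subV τ σ (suc i) = trans (subV-renV (liftS (liftS τ)) _ (σ i))
  (trans (subV-cong (λ j → renV-∘ suc suc (τ j)) (σ i)) (sym (renV-subV _ τ (σ i))))

mutual
  subV-subV : ∀ {n m k} (τ : Sub m k) (σ : Sub n m) V → subV τ (subV σ V) ≡ subV (subV τ ∘ σ) V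
  subV-subV τ σ (var x) = refl
  subV-subV τ σ (lam M) = cong lam (trans (subT-subT _ _ M) (subT-cong (liftS-subV τ σ) M))

  subT-subT : ∀ {n m k} (τ : Sub m k) (σ : Sub n m) M → subT τ (subT σ M) ≡ subT (subV τ ∘ σ) M
  subT-subT τ σ (up V)      = cong up (subV-subV τ σ V)
  subT-subT τ σ (app y W P) = subT-subApp τ σ (σ y) W P
  subT-subT τ σ (cut M N)   =
    cong₂ cut (subT-subT τ σ M) (trans (subT-subT _ _ N) (subT-cong (liftS-subV τ σ) N))

  subT-subApp : ∀ {n m k} (τ : Sub m k) (σ : Sub n m) X W P →
                subT τ (subApp σ X W P) ≡ subApp (subV τ ∘ σ) (subV τ X) W P
  subT-subApp τ σ (var x) W P = subApp-subApp τ σ (τ x) W P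
  subT-subApp τ σ (lam M) W P = cong (cut (up (lam (subT (liftS τ) M)))) (cong₂ (app zero)
    (trans (subV-liftS-wkV τ (subV σ W)) (cong wkV (subV-subV τ σ W)))
    (trans (subT-subT _ _ P) (subT-cong (liftS-liftS₂-subV τ σ) P)))

  subApp-subApp : ∀ {n m k} (τ : Sub m k) (σ : Sub n m) Y W P →
                  subApp τ Y (subV σ W) (subT (liftS σ) P) ≡ subApp (subV τ ∘ σ) Y W P
  subApp-subApp τ σ (var z) W P =
    cong₂ (app z) (subV-subV τ σ W) (trans (subT-subT _ _ P) (subT-cong (liftS-subV τ σ) P))
  subApp-subApp τ σ (lam N) W P = cong (cut (up (lam N))) (cong₂ (app zero)
    (cong wkV (subV-subV τ σ W)) (trans (subT-subT _ _ P) (subT-cong (liftS₂-subV τ σ) P)))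

liftS-var : ∀ {n} → liftS {n} var ≗ var
liftS-var zero    = refl
liftS-var (suc i) = refl

mutual
  subV-id : ∀ {n} (V : Val n) → subV var V ≡ V
  subV-id (var x) = refl
  subV-id (lam M) = cong lam (subT-id-under M)

  subT-id : ∀ {n} (M : Tm n) → subT var M ≡ M
  subT-id (up V)      = cong up (subV-id V)
  subT-id (app y W P) = cong₂ (app y) (subV-id W) (subT-id-under P)
  subT-id (cut M N)   = cong₂ cut (subT-id M) (subT-id-under N)

  subT-id-under : ∀ {n} (M : Tm (suc n)) → subT (liftS var) M ≡ M
  subT-id-under M = trans (subT-cong liftS-var M) (subT-id M)

subV-single-wkV : ∀ {n} (V : Val n) W → subV (single V) (wkV W) ≡ W
subV-single-wkV V W = trans (subV-renV (single V) suc W) (subV-id W)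

subV-∘-single : ∀ {n m} (σ : Sub n m) V → subV σ ∘ single V ≗ subV (single (subV σ V)) ∘ liftS σ
subV-∘-single σ V zero    = refl
subV-∘-single σ V (suc i) = sym (subV-single-wkV _ (σ i))

subV-single-commute : ∀ {n m} (σ : Sub n m) V W →
  subV σ (subV (single V) W) ≡ subV (single (subV σ V)) (subV (liftS σ) W)
subV-single-commute σ V W =
  trans (subV-subV σ (single V) W) (trans (subV-cong (subV-∘-single σ V) W) (sym (subV-subV _ _ W)))

subT-single-commute : ∀ {n m} (σ : Sub n m) V N →
  subT σ (subT (single V) N) ≡ subT (single (subV σ V)) (subT (liftS σ) N)
subT-single-commute σ V N =
  trans (subT-subT σ (single V) N) (trans (subT-cong (subV-∘-single σ V) N) (sym (subT-subT _ _ N)))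

subT-liftS-single-commute : ∀ {n m} (σ : Sub n m) V P →
  subT (liftS σ) (subT (liftS (single V)) P) ≡
  subT (liftS (single (subV σ V))) (subT (liftS (liftS σ)) P)
subT-liftS-single-commute σ V P =
  trans (subT-subT _ _ P) (trans (subT-cong commute P) (sym (subT-subT _ _ P)))
  where
  commute : subV (liftS σ) ∘ liftS (single V) ≗
            subV (liftS (single (subV σ V))) ∘ liftS (liftS σ)
  commute i = trans (liftS-subV σ (single V) i)
    (trans (liftS-cong (subV-∘-single σ V) i) (sym (liftS-subV _ (liftS σ) i)))

renV-∘-single : ∀ {n m} (ρ : Ren n m) V → renV ρ ∘ single V ≗ single (renV ρ V) ∘ liftR ρ
renV-∘-single ρ V zero    = refl
renV-∘-single ρ V (suc i) = refl

renV-single-commute : ∀ {n m} (ρ : Ren n m) V W →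
  renV ρ (subV (single V) W) ≡ subV (single (renV ρ V)) (renV (liftR ρ) W)
renV-single-commute ρ V W =
  trans (renV-subV ρ _ W) (trans (subV-cong (renV-∘-single ρ V) W) (sym (subV-renV _ _ W)))

renT-single-commute : ∀ {n m} (ρ : Ren n m) V N →
  renT ρ (subT (single V) N) ≡ subT (single (renV ρ V)) (renT (liftR ρ) N)
renT-single-commute ρ V N =
  trans (renT-subT ρ _ N) (trans (subT-cong (renV-∘-single ρ V) N) (sym (subT-renT _ _ N)))

renT-liftS-single-commute : ∀ {n m} (ρ : Ren n m) V P →
  renT (liftR ρ) (subT (liftS (single V)) P) ≡
  subT (liftS (single (renV ρ V))) (renT (liftR (liftR ρ)) P)
renT-liftS-single-commute ρ V P =
  trans (renT-subT _ _ P) (trans (subT-cong commute P) (sym (subT-renT _ _ P)))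
  where
  commute : renV (liftR ρ) ∘ liftS (single V) ≗ liftS (single (renV ρ V)) ∘ liftR (liftR ρ)
  commute zero          = refl
  commute (suc zero)    = renV-wkV ρ V
  commute (suc (suc i)) = refl

subT-liftS-wk₁ : ∀ {n m} (σ : Sub n m) N →
                 subT (liftS (liftS σ)) (wk₁ N) ≡ wk₁ (subT (liftS σ) N)
subT-liftS-wk₁ σ N = trans (subT-renT _ _ N) (trans (subT-cong swap N) (sym (renT-subT _ _ N)))
  where
  swap : liftS (liftS σ) ∘ liftR suc ≗ renV (liftR suc) ∘ liftS σ
  swap zero    = refl
  swap (suc i) = trans (renV-∘ suc suc (σ i)) (sym (renV-∘ (liftR suc) suc (σ i)))

subT-liftS₂ : ∀ {n m} (σ : Sub n m) P → subT (liftS₂ σ) P ≡ wk₁ (subT (liftS σ) P)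
subT-liftS₂ σ P = trans (subT-cong liftS₂-as-wk P) (sym (renT-subT _ _ P))
  where
  liftS₂-as-wk : liftS₂ σ ≗ renV (liftR suc) ∘ liftS σ
  liftS₂-as-wk zero    = refl
  liftS₂-as-wk (suc i) = sym (renV-∘ (liftR suc) suc (σ i))

subT-liftS-single-wk₁ : ∀ {n} (V : Val n) N → subT (liftS (single V)) (wk₁ N) ≡ N
subT-liftS-single-wk₁ V N = trans (subT-renT _ _ N) (trans (subT-cong cancel N) (subT-id N))
  where
  cancel : liftS (single V) ∘ liftR suc ≗ var
  cancel zero    = refl
  cancel (suc i) = refl

-- plug M N is C(M, x.N) with N pushed by π₁/π₂ into the tail position of M, an ↑V.
plug : ∀ {n} → Tm n → Tm (suc n) → Tm n
plug (up V)      N = cut (up V) N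
plug (app x V P) N = app x V (plug P (wk₁ N))
plug (cut M P)   N = cut M (plug P (wk₁ N))

mutual
  renT-plug : ∀ {n m} (ρ : Ren n m) M N → renT ρ (plug M N) ≡ plug (renT ρ M) (renT (liftR ρ) N)
  renT-plug ρ (up V)      N = refl
  renT-plug ρ (app x V P) N = cong (app (ρ x) (renV ρ V)) (renT-plug-tail ρ P N)
  renT-plug ρ (cut M P)   N = cong (cut (renT ρ M)) (renT-plug-tail ρ P N)

  renT-plug-tail : ∀ {n m} (ρ : Ren n m) P N →
    renT (liftR ρ) (plug P (wk₁ N)) ≡ plug (renT (liftR ρ) P) (wk₁ (renT (liftR ρ) N))
  renT-plug-tail ρ P N =
    trans (renT-plug (liftR ρ) P (wk₁ N)) (cong (plug (renT (liftR ρ) P)) (renT-wk₁ ρ N))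

mutual
  subT-plug : ∀ {n m} (σ : Sub n m) M N → subT σ (plug M N) ≡ plug (subT σ M) (subT (liftS σ) N)
  subT-plug σ (up V)      N = refl
  subT-plug σ (app x V P) N = subApp-plug σ (σ x) V P N
  subT-plug σ (cut M P)   N = cong (cut (subT σ M)) (subT-plug-tail σ P N)

  subT-plug-tail : ∀ {n m} (σ : Sub n m) P N →
    subT (liftS σ) (plug P (wk₁ N)) ≡ plug (subT (liftS σ) P) (wk₁ (subT (liftS σ) N))
  subT-plug-tail σ P N =
    trans (subT-plug (liftS σ) P (wk₁ N)) (cong (plug (subT (liftS σ) P)) (subT-liftS-wk₁ σ N))

  subApp-plug : ∀ {n m} (σ : Sub n m) X V P N →
    subApp σ X V (plug P (wk₁ N)) ≡ plug (subApp σ X V P) (subT (liftS σ) N)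
  subApp-plug σ (var x) V P N = cong (app x (subV σ V)) (subT-plug-tail σ P N)
  subApp-plug σ (lam M) V P N = cong (cut (up (lam M))) (cong (app zero (wkV (subV σ V))) (begin
      subT (liftS₂ σ) (plug P (wk₁ N))
        ≡⟨ subT-liftS₂ σ (plug P (wk₁ N)) ⟩
      wk₁ (subT (liftS σ) (plug P (wk₁ N)))
        ≡⟨ cong wk₁ (subT-plug-tail σ P N) ⟩
      wk₁ (plug (subT (liftS σ) P) (wk₁ N′))
        ≡⟨ renT-plug-tail suc _ N′ ⟩
      plug (wk₁ (subT (liftS σ) P)) (wk₁ (wk₁ N′))
        ≡⟨ cong (λ Q → plug Q (wk₁ (wk₁ N′))) (sym (subT-liftS₂ σ P)) ⟩
      plug (subT (liftS₂ σ) P) (wk₁ (wk₁ N′)) ∎))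
    where
    open ≡-Reasoning
    N′ = subT (liftS σ) N

mutual
  plug-assoc : ∀ {n} (M : Tm n) N P → plug (plug M N) P ≡ plug M (plug N (wk₁ P))
  plug-assoc (up V)      N P = refl
  plug-assoc (app x V Q) N P = cong (app x V) (plug-assoc-tail Q N P)
  plug-assoc (cut M Q)   N P = cong (cut M) (plug-assoc-tail Q N P)

  plug-assoc-tail : ∀ {n} (Q : Tm (suc n)) N P →
                    plug (plug Q (wk₁ N)) (wk₁ P) ≡ plug Q (wk₁ (plug N (wk₁ P)))
  plug-assoc-tail Q N P =
    trans (plug-assoc Q (wk₁ N) (wk₁ P)) (cong (plug Q) (sym (renT-plug-tail suc N P)))

mutual
  πnfV : ∀ {n} → Val n → Val n
  πnfV (var x) = var x
  πnfV (lam M) = lam (πnfT M)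

  πnfT : ∀ {n} → Tm n → Tm n
  πnfT (up V)      = up (πnfV V)
  πnfT (app x V N) = app x (πnfV V) (πnfT N)
  πnfT (cut M N)   = plug (πnfT M) (πnfT N)

mutual
  πnfV-renV : ∀ {n m} (ρ : Ren n m) V → πnfV (renV ρ V) ≡ renV ρ (πnfV V)
  πnfV-renV ρ (var x) = refl
  πnfV-renV ρ (lam M) = cong lam (πnfT-renT (liftR ρ) M)

  πnfT-renT : ∀ {n m} (ρ : Ren n m) M → πnfT (renT ρ M) ≡ renT ρ (πnfT M)
  πnfT-renT ρ (up V)      = cong up (πnfV-renV ρ V)
  πnfT-renT ρ (app x V N) = cong₂ (app (ρ x)) (πnfV-renV ρ V) (πnfT-renT (liftR ρ) N)
  πnfT-renT ρ (cut M N)   =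
    trans (cong₂ plug (πnfT-renT ρ M) (πnfT-renT (liftR ρ) N)) (sym (renT-plug ρ (πnfT M) (πnfT N)))

πnfV-liftS : ∀ {n m} (σ : Sub n m) → πnfV ∘ liftS σ ≗ liftS (πnfV ∘ σ)
πnfV-liftS σ zero    = refl
πnfV-liftS σ (suc i) = πnfV-renV suc (σ i)

πnfV-liftS₂ : ∀ {n m} (σ : Sub n m) → πnfV ∘ liftS₂ σ ≗ liftS₂ (πnfV ∘ σ)
πnfV-liftS₂ σ zero    = refl
πnfV-liftS₂ σ (suc i) = πnfV-renV _ (σ i)

mutual
  πnfV-subV : ∀ {n m} (σ : Sub n m) V → πnfV (subV σ V) ≡ subV (πnfV ∘ σ) (πnfV V)
  πnfV-subV σ (var x) = refl
  πnfV-subV σ (lam M) = cong lam (trans (πnfT-subT (liftS σ) M) (subT-cong (πnfV-liftS σ) (πnfT M)))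

  πnfT-subT : ∀ {n m} (σ : Sub n m) M → πnfT (subT σ M) ≡ subT (πnfV ∘ σ) (πnfT M)
  πnfT-subT σ (up V)      = cong up (πnfV-subV σ V)
  πnfT-subT σ (app y W P) = πnfT-subApp σ (σ y) W P
  πnfT-subT σ (cut M N)   = trans
    (cong₂ plug (πnfT-subT σ M) (trans (πnfT-subT (liftS σ) N) (subT-cong (πnfV-liftS σ) (πnfT N))))
    (sym (subT-plug _ (πnfT M) (πnfT N)))

  πnfT-subApp : ∀ {n m} (σ : Sub n m) X W P →
    πnfT (subApp σ X W P) ≡ subApp (πnfV ∘ σ) (πnfV X) (πnfV W) (πnfT P)
  πnfT-subApp σ (var x) W P = cong₂ (app x) (πnfV-subV σ W)
    (trans (πnfT-subT (liftS σ) P) (subT-cong (πnfV-liftS σ) (πnfT P)))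
  πnfT-subApp σ (lam M) W P = cong (cut (up (lam (πnfT M)))) (cong₂ (app zero)
    (trans (πnfV-renV suc (subV σ W)) (cong wkV (πnfV-subV σ W)))
    (trans (πnfT-subT (liftS₂ σ) P) (subT-cong (πnfV-liftS₂ σ) (πnfT P))))

πnfT-single : ∀ {n} (V : Val n) N → πnfT (subT (single V) N) ≡ subT (single (πnfV V)) (πnfT N)
πnfT-single V N = trans (πnfT-subT (single V) N) (subT-cong commute (πnfT N))
  where
  commute : πnfV ∘ single V ≗ single (πnfV V)
  commute zero    = refl
  commute (suc i) = refl

-- Contracting σ on C(↑λx.M, y.y(W, z.P)) yields C(↑λx.M, y′.y′([λx.M/y]W, z.[λx.M/y]P)), a
-- B_v-redex; this is its contractum followed by π₂ and the π-steps of plug.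
σB-contractum : ∀ {n} → Tm (suc n) → Val (suc n) → Tm (suc (suc n)) → Tm n
σB-contractum M W P =
  cut (up (subV (single (lam M)) W)) (plug M (wk₁ (subT (liftS (single (lam M))) P)))

infix 4 _⇛_ _⇛V_
mutual
  data _⇛V_ {n : ℕ} : Val n → Val n → Set where
    pvar : ∀ {x} → var x ⇛V var x
    plam : ∀ {M M′} → M ⇛ M′ → lam M ⇛V lam M′

  data _⇛_ {n : ℕ} : Tm n → Tm n → Set where
    pup  : ∀ {V V′} → V ⇛V V′ → up V ⇛ up V′
    papp : ∀ {x V V′ N N′} → V ⇛V V′ → N ⇛ N′ → app x V N ⇛ app x V′ N′
    pcut : ∀ {M M′ N N′} → M ⇛ M′ → N ⇛ N′ → cut M N ⇛ cut M′ N′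
    pσ   : ∀ {V V′ N N′} → V ⇛V V′ → N ⇛ N′ → cut (up V) N ⇛ subT (single V′) N′
    pσB  : ∀ {M M′ W W′ P P′} → M ⇛ M′ → W ⇛V W′ → P ⇛ P′ →
           cut (up (lam M)) (app zero W P) ⇛ σB-contractum M′ W′ P′

⇛-respʳ-≡ : ∀ {n} {M N N′ : Tm n} → N ≡ N′ → M ⇛ N → M ⇛ N′
⇛-respʳ-≡ refl p = p

mutual
  ⇛V-refl : ∀ {n} (V : Val n) → V ⇛V V
  ⇛V-refl (var x) = pvar
  ⇛V-refl (lam M) = plam (⇛-refl M)

  ⇛-refl : ∀ {n} (M : Tm n) → M ⇛ M
  ⇛-refl (up V)      = pup (⇛V-refl V)
  ⇛-refl (app x V N) = papp (⇛V-refl V) (⇛-refl N)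
  ⇛-refl (cut M N)   = pcut (⇛-refl M) (⇛-refl N)

renT-σB-contractum : ∀ {n m} (ρ : Ren n m) M W P →
  renT ρ (σB-contractum M W P) ≡
  σB-contractum (renT (liftR ρ) M) (renV (liftR ρ) W) (renT (liftR (liftR ρ)) P)
renT-σB-contractum ρ M W P = cong₂ cut (cong up (renV-single-commute ρ (lam M) W))
  (trans (renT-plug-tail ρ M _)
         (cong (plug (renT (liftR ρ) M) ∘ wk₁) (renT-liftS-single-commute ρ (lam M) P)))

subT-σB-contractum : ∀ {n m} (σ : Sub n m) M W P →
  subT σ (σB-contractum M W P) ≡
  σB-contractum (subT (liftS σ) M) (subV (liftS σ) W) (subT (liftS (liftS σ)) P)
subT-σB-contractum σ M W P = cong₂ cut (cong up (subV-single-commute σ (lam M) W))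
  (trans (subT-plug-tail σ M _)
         (cong (plug (subT (liftS σ) M) ∘ wk₁) (subT-liftS-single-commute σ (lam M) P)))

mutual
  ⇛V-ren : ∀ {n m} (ρ : Ren n m) {V V′} → V ⇛V V′ → renV ρ V ⇛V renV ρ V′
  ⇛V-ren ρ pvar     = pvar
  ⇛V-ren ρ (plam p) = plam (⇛-ren (liftR ρ) p)

  ⇛-ren : ∀ {n m} (ρ : Ren n m) {M M′} → M ⇛ M′ → renT ρ M ⇛ renT ρ M′
  ⇛-ren ρ (pup v)    = pup (⇛V-ren ρ v)
  ⇛-ren ρ (papp v p) = papp (⇛V-ren ρ v) (⇛-ren (liftR ρ) p)
  ⇛-ren ρ (pcut p q) = pcut (⇛-ren ρ p) (⇛-ren (liftR ρ) q)
  ⇛-ren ρ (pσ {V′ = V′} {N′ = N′} v p) =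
    ⇛-respʳ-≡ (sym (renT-single-commute ρ V′ N′)) (pσ (⇛V-ren ρ v) (⇛-ren (liftR ρ) p))
  ⇛-ren ρ (pσB {M′ = M′} {W′ = W′} {P′ = P′} m w p) =
    ⇛-respʳ-≡ (sym (renT-σB-contractum ρ M′ W′ P′))
      (pσB (⇛-ren (liftR ρ) m) (⇛V-ren (liftR ρ) w) (⇛-ren (liftR (liftR ρ)) p))

infix 4 _⇛ˢ_
_⇛ˢ_ : ∀ {n m} → Sub n m → Sub n m → Set
σ ⇛ˢ σ′ = ∀ i → σ i ⇛V σ′ i

⇛ˢ-liftS : ∀ {n m} {σ σ′ : Sub n m} → σ ⇛ˢ σ′ → liftS σ ⇛ˢ liftS σ′
⇛ˢ-liftS s zero    = pvar
⇛ˢ-liftS s (suc i) = ⇛V-ren suc (s i)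

⇛ˢ-liftS₂ : ∀ {n m} {σ σ′ : Sub n m} → σ ⇛ˢ σ′ → liftS₂ σ ⇛ˢ liftS₂ σ′
⇛ˢ-liftS₂ s zero    = pvar
⇛ˢ-liftS₂ s (suc i) = ⇛V-ren _ (s i)

⇛ˢ-single : ∀ {n} {V V′ : Val n} → V ⇛V V′ → single V ⇛ˢ single V′
⇛ˢ-single v zero    = v
⇛ˢ-single v (suc i) = pvar

mutual
  ⇛V-sub : ∀ {n m} {σ σ′ : Sub n m} → σ ⇛ˢ σ′ →
           ∀ {V V′} → V ⇛V V′ → subV σ V ⇛V subV σ′ V′
  ⇛V-sub s (pvar {x}) = s x
  ⇛V-sub s (plam p)   = plam (⇛-sub (⇛ˢ-liftS s) p)

  ⇛-sub : ∀ {n m} {σ σ′ : Sub n m} → σ ⇛ˢ σ′ →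
          ∀ {M M′} → M ⇛ M′ → subT σ M ⇛ subT σ′ M′
  ⇛-sub s (pup v)              = pup (⇛V-sub s v)
  ⇛-sub s (papp {x = x} v p)   = ⇛-subApp s (s x) v p
  ⇛-sub s (pcut p q)           = pcut (⇛-sub s p) (⇛-sub (⇛ˢ-liftS s) q)
  ⇛-sub {σ′ = σ′} s (pσ {V′ = V′} {N′ = N′} v p) =
    ⇛-respʳ-≡ (sym (subT-single-commute σ′ V′ N′)) (pσ (⇛V-sub s v) (⇛-sub (⇛ˢ-liftS s) p))
  ⇛-sub {σ′ = σ′} s (pσB {M′ = M′} {W′ = W′} {P′ = P′} m w p) =
    ⇛-respʳ-≡ (sym (subT-σB-contractum σ′ M′ W′ P′))
      (pσB (⇛-sub (⇛ˢ-liftS s) m) (⇛V-sub (⇛ˢ-liftS s) w) (⇛-sub (⇛ˢ-liftS (⇛ˢ-liftS s)) p))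

  ⇛-subApp : ∀ {n m} {σ σ′ : Sub n m} → σ ⇛ˢ σ′ → ∀ {X X′ W W′ P P′} →
             X ⇛V X′ → W ⇛V W′ → P ⇛ P′ → subApp σ X W P ⇛ subApp σ′ X′ W′ P′
  ⇛-subApp s pvar     w p = papp (⇛V-sub s w) (⇛-sub (⇛ˢ-liftS s) p)
  ⇛-subApp s (plam q) w p =
    pcut (pup (plam q)) (papp (⇛V-ren suc (⇛V-sub s w)) (⇛-sub (⇛ˢ-liftS₂ s) p))

subT-single-plug : ∀ {n} (V : Val n) N B → subT (single V) (plug N (wk₁ B)) ≡ plug (subT (single V) N) B
subT-single-plug V N B =
  trans (subT-plug (single V) N (wk₁ B)) (cong (plug (subT (single V) N)) (subT-liftS-single-wk₁ V B))

σB-contractum-plug : ∀ {n} M W P (B : Tm (suc n)) →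
  σB-contractum M W (plug P (wk₁ (wk₁ B))) ≡ plug (σB-contractum M W P) B
σB-contractum-plug M W P B = cong (cut (up (subV s W))) (begin
    plug M (wk₁ (subT (liftS s) (plug P (wk₁ (wk₁ B)))))
      ≡⟨ cong (plug M ∘ wk₁) (subT-plug-tail s P (wk₁ B)) ⟩
    plug M (wk₁ (plug Y (wk₁ (subT (liftS s) (wk₁ B)))))
      ≡⟨ cong (λ B′ → plug M (wk₁ (plug Y (wk₁ B′)))) (subT-liftS-single-wk₁ (lam M) B) ⟩
    plug M (wk₁ (plug Y (wk₁ B)))
      ≡⟨ sym (plug-assoc-tail M Y B) ⟩
    plug (plug M (wk₁ Y)) (wk₁ B) ∎)
  where
  open ≡-Reasoning
  s = single (lam M)
  Y = subT (liftS s) P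

⇛-σ : ∀ {n} {V V′ : Val n} {N N′} → V ⇛V V′ → N ⇛ N′ → subT (single V) N ⇛ subT (single V′) N′
⇛-σ v = ⇛-sub (⇛ˢ-single v)

⇛-plug : ∀ {n} {A A′ : Tm n} {B B′} → A ⇛ A′ → B ⇛ B′ → plug A B ⇛ plug A′ B′
⇛-plug (pup v)    b = pcut (pup v) b
⇛-plug (papp v p) b = papp v (⇛-plug p (⇛-ren (liftR suc) b))
⇛-plug (pcut m p) b = pcut m (⇛-plug p (⇛-ren (liftR suc) b))
⇛-plug {B′ = B′} (pσ {V′ = V′} {N′ = N′} v p) b =
  ⇛-respʳ-≡ (subT-single-plug V′ N′ B′) (pσ v (⇛-plug p (⇛-ren (liftR suc) b)))
⇛-plug {B′ = B′} (pσB {M′ = M′} {W′ = W′} {P′ = P′} m w p) b =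
  ⇛-respʳ-≡ (σB-contractum-plug M′ W′ P′ B′)
    (pσB m w (⇛-plug p (⇛-ren (liftR suc) (⇛-ren (liftR suc) b))))

⇛-σB-contractum : ∀ {n} {M M′ : Tm (suc n)} {W W′ P P′} → M ⇛ M′ → W ⇛V W′ → P ⇛ P′ →
                  σB-contractum M W P ⇛ σB-contractum M′ W′ P′
⇛-σB-contractum m w p = pcut (pup (⇛V-sub s w))
  (⇛-plug m (⇛-ren (liftR suc) (⇛-sub (⇛ˢ-liftS s) p)))
  where
  s = ⇛ˢ-single (plam m)

-- The B_v-redex created by σ-contraction has the same σB-contractum as the original redex.
σB-contractum-after-σ : ∀ {n} (M : Tm (suc n)) W P →
  σB-contractum M (wkV (subV (single (lam M)) W)) (subT (liftS₂ (single (lam M))) P) ≡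
  σB-contractum M W P
σB-contractum-after-σ M W P = cong₂ cut (cong up (subV-single-wkV (lam M) _))
  (cong (plug M ∘ wk₁)
    (trans (cong (subT (liftS s)) (subT-liftS₂ s P)) (subT-liftS-single-wk₁ (lam M) _)))
  where
  s = single (lam M)

mutual
  devV : ∀ {n} → Val n → Val n
  devV (var x) = var x
  devV (lam M) = lam (devT M)

  devT : ∀ {n} → Tm n → Tm n
  devT (up V)                                  = up (devV V)
  devT (app x V N)                             = app x (devV V) (devT N)
  devT (cut (up (var x)) N)                    = subT (single (var x)) (devT N)
  devT (cut (up (lam M)) (app zero W P))       = σB-contractum (devT M) (devV W) (devT P)
  devT (cut (up (lam M)) N@(up _))             = subT (single (lam (devT M))) (devT N)
  devT (cut (up (lam M)) N@(app (suc _) _ _))  = subT (single (lam (devT M))) (devT N)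
  devT (cut (up (lam M)) N@(cut _ _))          = subT (single (lam (devT M))) (devT N)
  devT (cut M@(app _ _ _) N)                   = cut (devT M) (devT N)
  devT (cut M@(cut _ _) N)                     = cut (devT M) (devT N)

mutual
  ⇛V-dev : ∀ {n} {V V′ : Val n} → V ⇛V V′ → V′ ⇛V devV V
  ⇛V-dev pvar     = pvar
  ⇛V-dev (plam p) = plam (⇛-dev p)

  ⇛-dev : ∀ {n} {M M′ : Tm n} → M ⇛ M′ → M′ ⇛ devT M
  ⇛-dev (pup v)                                        = pup (⇛V-dev v)
  ⇛-dev (papp v p)                                     = papp (⇛V-dev v) (⇛-dev p)
  ⇛-dev (pcut (pup pvar) q)                            = pσ pvar (⇛-dev q)
  ⇛-dev (pcut (pup (plam m)) (papp {x = zero} w p))    = pσB (⇛-dev m) (⇛V-dev w) (⇛-dev p)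
  ⇛-dev (pcut (pup (plam m)) q@(pup _))                = pσ (plam (⇛-dev m)) (⇛-dev q)
  ⇛-dev (pcut (pup (plam m)) q@(papp {x = suc _} _ _)) = pσ (plam (⇛-dev m)) (⇛-dev q)
  ⇛-dev (pcut (pup (plam m)) q@(pcut _ _))             = pσ (plam (⇛-dev m)) (⇛-dev q)
  ⇛-dev (pcut (pup (plam m)) q@(pσ _ _))               = pσ (plam (⇛-dev m)) (⇛-dev q)
  ⇛-dev (pcut (pup (plam m)) q@(pσB _ _ _))            = pσ (plam (⇛-dev m)) (⇛-dev q)
  ⇛-dev (pcut m@(papp _ _) q)                          = pcut (⇛-dev m) (⇛-dev q)
  ⇛-dev (pcut m@(pcut _ _) q)                          = pcut (⇛-dev m) (⇛-dev q)
  ⇛-dev (pcut m@(pσ _ _) q)                            = pcut (⇛-dev m) (⇛-dev q)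
  ⇛-dev (pcut m@(pσB _ _ _) q)                         = pcut (⇛-dev m) (⇛-dev q)
  ⇛-dev (pσ pvar q)                                    = ⇛-σ pvar (⇛-dev q)
  ⇛-dev (pσ (plam {M = M} m) (papp {x = zero} {V = W} {N = P} w p)) =
    ⇛-respʳ-≡ (σB-contractum-after-σ (devT M) (devV W) (devT P))
      (pσB (⇛-dev m) (⇛V-ren suc (⇛V-sub s (⇛V-dev w))) (⇛-sub (⇛ˢ-liftS₂ s) (⇛-dev p)))
    where
    s = ⇛ˢ-single (plam (⇛-dev m))
  ⇛-dev (pσ (plam m) q@(pup _))                        = ⇛-σ (plam (⇛-dev m)) (⇛-dev q)
  ⇛-dev (pσ (plam m) q@(papp {x = suc _} _ _))         = ⇛-σ (plam (⇛-dev m)) (⇛-dev q)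
  ⇛-dev (pσ (plam m) q@(pcut _ _))                     = ⇛-σ (plam (⇛-dev m)) (⇛-dev q)
  ⇛-dev (pσ (plam m) q@(pσ _ _))                       = ⇛-σ (plam (⇛-dev m)) (⇛-dev q)
  ⇛-dev (pσ (plam m) q@(pσB _ _ _))                    = ⇛-σ (plam (⇛-dev m)) (⇛-dev q)
  ⇛-dev (pσB m w p)                                    = ⇛-σB-contractum (⇛-dev m) (⇛V-dev w) (⇛-dev p)

σB-contractum-Bv : ∀ {n} (M : Tm (suc n)) V N →
  σB-contractum M (wkV V) (wk₁ N) ≡ cut (up V) (plug M (wk₁ N))
σB-contractum-Bv M V N =
  cong₂ cut (cong up (subV-single-wkV (lam M) V))
            (cong (plug M ∘ wk₁) (subT-liftS-single-wk₁ (lam M) N))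

plug-η : ∀ {n} (M : Tm n) → plug M (up (var zero)) ⇛ M
plug-η (up V)      = pσ (⇛V-refl V) (⇛-refl (up (var zero)))
plug-η (app x V P) = papp (⇛V-refl V) (plug-η P)
plug-η (cut M P)   = pcut (⇛-refl M) (plug-η P)

mutual
  ⟶V-πnf-⇛ : ∀ {n} {V V′ : Val n} → V ⟶V V′ → πnfV V ⇛V πnfV V′
  ⟶V-πnf-⇛ (ξ-lam p) = plam (⟶-πnf-⇛ p)

  ⟶-πnf-⇛ : ∀ {n} {M N : Tm n} → M ⟶ N → πnfT M ⇛ πnfT N
  ⟶-πnf-⇛ (Bv {M} {V} {N}) =
    ⇛-respʳ-≡ (trans (cong₂ (σB-contractum (πnfT M)) (πnfV-renV suc V) (πnfT-renT (liftR suc) N))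
                     (σB-contractum-Bv (πnfT M) (πnfV V) (πnfT N)))
      (pσB (⇛-refl _) (⇛V-refl _) (⇛-refl _))
  ⟶-πnf-⇛ (σv {V} {N} _) = ⇛-respʳ-≡ (sym (πnfT-single V N)) (pσ (⇛V-refl _) (⇛-refl _))
  ⟶-πnf-⇛ (ηcut {M}) = plug-η (πnfT M)
  ⟶-πnf-⇛ (π₁ {z} {V} {P} {N}) =
    ⇛-respʳ-≡ (cong (app z (πnfV V) ∘ plug (πnfT P)) (sym (πnfT-renT (liftR suc) N))) (⇛-refl _)
  ⟶-πnf-⇛ (π₂ {M} {P} {N}) =
    ⇛-respʳ-≡ (trans (plug-assoc (πnfT M) (πnfT P) (πnfT N))
                     (cong (plug (πnfT M) ∘ plug (πnfT P)) (sym (πnfT-renT (liftR suc) N))))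
      (⇛-refl _)
  ⟶-πnf-⇛ (ξ-up v)    = pup (⟶V-πnf-⇛ v)
  ⟶-πnf-⇛ (ξ-appV v)  = papp (⟶V-πnf-⇛ v) (⇛-refl _)
  ⟶-πnf-⇛ (ξ-appN p)  = papp (⇛V-refl _) (⟶-πnf-⇛ p)
  ⟶-πnf-⇛ (ξ-cutL p)  = ⇛-plug (⟶-πnf-⇛ p) (⇛-refl _)
  ⟶-πnf-⇛ (ξ-cutR p)  = ⇛-plug (⇛-refl _) (⟶-πnf-⇛ p)

infix 4 _⟶V*_
_⟶V*_ : ∀ {n} → Val n → Val n → Set
_⟶V*_ = Star _⟶V_

ξ*-lam : ∀ {n} {M M′ : Tm (suc n)} → M ⟶* M′ → lam M ⟶V* lam M′
ξ*-lam = gmap lam ξ-lam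

ξ*-up : ∀ {n} {V V′ : Val n} → V ⟶V* V′ → up V ⟶* up V′
ξ*-up = gmap up ξ-up

ξ*-appV : ∀ {n} {x : Fin n} {V V′ N} → V ⟶V* V′ → app x V N ⟶* app x V′ N
ξ*-appV = gmap _ ξ-appV

ξ*-appN : ∀ {n} {x : Fin n} {V N N′} → N ⟶* N′ → app x V N ⟶* app x V N′
ξ*-appN = gmap _ ξ-appN

ξ*-cutL : ∀ {n} {M M′ : Tm n} {N} → M ⟶* M′ → cut M N ⟶* cut M′ N
ξ*-cutL = gmap _ ξ-cutL

ξ*-cutR : ∀ {n} {M : Tm n} {N N′} → N ⟶* N′ → cut M N ⟶* cut M N′
ξ*-cutR = gmap _ ξ-cutR

cut⟶*plug : ∀ {n} (M : Tm n) N → cut M N ⟶* plug M N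
cut⟶*plug (up V)      N = ε
cut⟶*plug (app x V P) N = π₁ ◅ ξ*-appN (cut⟶*plug P (wk₁ N))
cut⟶*plug (cut M P)   N = π₂ ◅ ξ*-cutR (cut⟶*plug P (wk₁ N))

IsBv⇒σ-contractum≡redex : ∀ {n} {V : Val n} {N} → IsBv V N → subT (single V) N ≡ cut (up V) N
IsBv⇒σ-contractum≡redex (M , W , N , refl , refl) = cong (cut (up (lam M))) (cong₂ (app zero)
  (cong wkV (subV-single-wkV (lam M) W))
  (trans (subT-liftS₂ (single (lam M)) (wk₁ N)) (cong wk₁ (subT-liftS-single-wk₁ (lam M) N))))

mutual
  _≟V_ : ∀ {n} (V W : Val n) → Dec (V ≡ W)
  var x ≟V var y = map′ (cong var) (λ { refl → refl }) (x Fin.≟ y)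
  var x ≟V lam N = no λ ()
  lam M ≟V var y = no λ ()
  lam M ≟V lam N = map′ (cong lam) (λ { refl → refl }) (M ≟T N)

  _≟T_ : ∀ {n} (M N : Tm n) → Dec (M ≡ N)
  up V        ≟T up W        = map′ (cong up) (λ { refl → refl }) (V ≟V W)
  app x V M   ≟T app y W N   =
    map′ (λ { (refl , refl , refl) → refl }) (λ { refl → refl , refl , refl })
         (x Fin.≟ y ×-dec V ≟V W ×-dec M ≟T N)
  cut M₁ M₂   ≟T cut N₁ N₂   =
    map′ (λ { (refl , refl) → refl }) (λ { refl → refl , refl }) (M₁ ≟T N₁ ×-dec M₂ ≟T N₂)
  up _        ≟T app _ _ _   = no λ ()
  up _        ≟T cut _ _     = no λ ()
  app _ _ _   ≟T up _        = no λ ()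
  app _ _ _   ≟T cut _ _     = no λ ()
  cut _ _     ≟T up _        = no λ ()
  cut _ _     ≟T app _ _ _   = no λ ()

-- Where rule σ_v is blocked, σ-contraction does not change the term, so it suffices to decide
-- that instead of IsBv.
σ-reduces : ∀ {n} (V : Val n) N → cut (up V) N ⟶* subT (single V) N
σ-reduces V N with cut (up V) N ≟T subT (single V) N
... | yes unchanged = subst (cut (up V) N ⟶*_) unchanged ε
... | no changed    = σv (λ isBv → changed (sym (IsBv⇒σ-contractum≡redex isBv))) ◅ ε

σB-reduces : ∀ {n} (M : Tm (suc n)) W P → cut (up (lam M)) (app zero W P) ⟶* σB-contractum M W P
σB-reduces M W P = begin
  cut (up (lam M)) (app zero W P)
    ⟶*⟨ σ-reduces (lam M) (app zero W P) ⟩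
  cut (up (lam M)) (app zero (wkV W′) (subT (liftS₂ s) P))
    ≡⟨ cong (cut (up (lam M)) ∘ app zero (wkV W′)) (subT-liftS₂ s P) ⟩
  cut (up (lam M)) (app zero (wkV W′) (wk₁ Y))
    ⟶⟨ Bv ⟩
  cut (cut (up W′) M) Y
    ⟶⟨ π₂ ⟩
  cut (up W′) (cut M (wk₁ Y))
    ⟶*⟨ ξ*-cutR (cut⟶*plug M (wk₁ Y)) ⟩
  cut (up W′) (plug M (wk₁ Y)) ∎
  where
  open StarReasoning _⟶_
  s  = single (lam M)
  W′ = subV s W
  Y  = subT (liftS s) P

mutual
  ⇛V⊆⟶V* : ∀ {n} {V V′ : Val n} → V ⇛V V′ → V ⟶V* V′
  ⇛V⊆⟶V* pvar     = ε
  ⇛V⊆⟶V* (plam p) = ξ*-lam (⇛⊆⟶* p)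

  ⇛⊆⟶* : ∀ {n} {M M′ : Tm n} → M ⇛ M′ → M ⟶* M′
  ⇛⊆⟶* (pup v)    = ξ*-up (⇛V⊆⟶V* v)
  ⇛⊆⟶* (papp v p) = ξ*-appV (⇛V⊆⟶V* v) ◅◅ ξ*-appN (⇛⊆⟶* p)
  ⇛⊆⟶* (pcut p q) = ξ*-cutL (⇛⊆⟶* p) ◅◅ ξ*-cutR (⇛⊆⟶* q)
  ⇛⊆⟶* (pσ {V′ = V′} {N′ = N′} v p) =
    ξ*-cutL (ξ*-up (⇛V⊆⟶V* v)) ◅◅ ξ*-cutR (⇛⊆⟶* p) ◅◅ σ-reduces V′ N′
  ⇛⊆⟶* (pσB {M′ = M′} {W′ = W′} {P′ = P′} m w p) =
    ξ*-cutL (ξ*-up (ξ*-lam (⇛⊆⟶* m)))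
      ◅◅ ξ*-cutR (ξ*-appV (⇛V⊆⟶V* w) ◅◅ ξ*-appN (⇛⊆⟶* p))
      ◅◅ σB-reduces M′ W′ P′

mutual
  ⟶V*-πnfV : ∀ {n} (V : Val n) → V ⟶V* πnfV V
  ⟶V*-πnfV (var x) = ε
  ⟶V*-πnfV (lam M) = ξ*-lam (⟶*-πnfT M)

  ⟶*-πnfT : ∀ {n} (M : Tm n) → M ⟶* πnfT M
  ⟶*-πnfT (up V)      = ξ*-up (⟶V*-πnfV V)
  ⟶*-πnfT (app x V N) = ξ*-appV (⟶V*-πnfV V) ◅◅ ξ*-appN (⟶*-πnfT N)
  ⟶*-πnfT (cut M N)   =
    ξ*-cutL (⟶*-πnfT M) ◅◅ ξ*-cutR (⟶*-πnfT N) ◅◅ cut⟶*plug (πnfT M) (πnfT N)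

corollary4 : ∀ {n} {M N₁ N₂ : Tm n} → M ⟶* N₁ → M ⟶* N₂ →
    ∃ λ P → (N₁ ⟶* P) × (N₂ ⟶* P)
corollary4 =
  confluent-by-interpretation πnfT ⟶*-πnfT ⟶-πnf-⇛ ⇛⊆⟶* (triangle⇒confluent devT ⇛-dev)
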